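{- Let $B=\{120,210\}$, and let $A(x,v)$ and $B(x,v,u)$ be the generating functions defined in the context. The generating function $\sum_{n\geq 0}|I_n(120,210)|\,x^{n+1}$ is equal to $A(x,0)$, and it satisfies $$A(x,0)=\frac{x}{1-x}+x\,B(x,x,1).$$
   Context: For $n\ge 0$, $I_n$ denotes the set of inversion sequences $e=e_0e_1\cdots e_n$, i.e. integer sequences with $0\le e_i\le i$ for each $0\le i\le n$. An inversion sequence contains a pattern $\tau$ if it has a (not necessarily consecutive) subsequence order isomorphic to $\tau$ (including equalities); otherwise it avoids $\tau$. $I_n(\tau_1,\dots,\tau_m)$ (also written $I_n(B)$ for $B=\{\tau_1,\dots,\tau_m\}$) is the set of $e\in I_n$ avoiding all $\tau_i$. $\mathcal T(B)$ is the rooted plane tree with root $0$ whose level-$n$ nodes are the elements of $I_n(B)$ (root at level 0), where the parent of $e_0\cdots e_n$ is $e_0\cdots e_{n-1}$ and siblings are ordered left to right by increasing last letter. For a node $e$, $\mathcal T(B;e)$ is the subtree consisting of $e$ and its descendants. The generating function for the number of nodes in $\mathcal T(B;e)$ is the power series in which a node at distance $\ell\ge 0$ below the root $e$ contributes $x^{\ell+1}$. Here $0^m$ is the word of $m$ zeros and $0^mj$ is $0^m$ followed by the letter $j$. Let $A_m(x)$ (for $m\ge1$) and $B_{m,j}(x)$ (for $1\le j\le m$) be the generating functions for the number of nodes in $\mathcal T(B;0^m)$ and $\mathcal T(B;0^mj)$ respectively, and set $$A(x,v)=\sum_{m\ge1}A_m(x)v^{m-1},\qquad B(x,v,u)=\sum_{m\ge1}\sum_{j=1}^m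 B_{m,j}(x)\,v^{m-1}u^{m-j}.$$ -}

module Defs where

open import Data.Fin using (Fin; zero; suc; toℕ)
import Data.Fin.Properties as Fin
open import Data.Integer as ℤ using (ℤ; 0ℤ; 1ℤ)
import Data.Integer.Properties as ℤ
open import Data.List using (List; []; _∷_; _∷ʳ_; length; map; foldr; filter; replicate; allFin; cartesianProductWith)
open import Data.List.Membership.Propositional using (_∈_)
open import Data.List.Membership.Propositional.Properties using (∈-cartesianProductWith⁺; ∈-allFin)
open import Data.List.Relation.Binary.Sublist.Propositional as Sublist using (_⊆_)
open import Data.List.Relation.Unary.All as All using (All)
open import Data.List.Relation.Unary.AllPairs using ([]; _∷_)
open import Data.List.Relation.Unary.Any using (here)
open import Data.List.Relation.Unary.Unique.Propositional using (Unique)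
import Data.List.Relation.Unary.Unique.Propositional.Properties as Unique
open import Data.Nat as ℕ using (ℕ; zero; suc; _+_; _∸_; _<_)
open import Data.Product using (∃; _×_; _,_)
open import Data.Sum using (_⊎_; inj₁; inj₂; [_,_]′)
open import Data.Vec as Vec using (Vec; []; _∷_; lookup; toList; fromList)
open import Function.Bundles using (_⇔_; mk⇔; Equivalence)
open import Relation.Binary.Definitions using (DecidableEquality)
open import Relation.Binary.PropositionalEquality using (_≡_; refl; cong)
open import Relation.Nullary using (¬_; Dec; yes; no)
open import Relation.Nullary.Decidable using (map′; _×-dec_; _→-dec_; _⊎-dec_; ¬?)
open import Relation.Unary using (Decidable)
open import Algebra.Properties.CommutativeMonoid.Sum ℤ.+-0-commutativeMonoid
  using (sum⁺-syntax; sum-replicate-zero)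

------------------------------------------------------------------------
-- Inversion sequences

infixl 5 _▹_

-- Indexed by length: the i-th letter (counting from 0) lies in
-- Fin (suc i), that is, 0 ≤ eᵢ ≤ i.
data InvSeq : ℕ → Set where
  ε   : InvSeq 0
  _▹_ : ∀ {n} → InvSeq n → Fin (suc n) → InvSeq (suc n)

-- Iₙ consists of the sequences e₀e₁⋯eₙ, which have length n + 1.
I : ℕ → Set
I n = InvSeq (suc n)

letters : ∀ {n} → InvSeq n → List ℕ
letters ε       = []
letters (e ▹ a) = letters e ∷ʳ toℕ a

zeros : ∀ m → InvSeq m
zeros zero    = ε
zeros (suc m) = zeros m ▹ zero

parent : ∀ {n} → InvSeq (suc n) → InvSeq n
parent (e ▹ _) = e

ancestor : ∀ ℓ {n} → InvSeq (ℓ + n) → InvSeq n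
ancestor zero    d = d
ancestor (suc ℓ) d = ancestor ℓ (parent d)

_≟_ : ∀ {n} → DecidableEquality (InvSeq n)
ε       ≟ ε       = yes refl
(e ▹ a) ≟ (f ▹ b) =
  map′ (λ { (refl , refl) → refl }) (λ { refl → refl , refl })
       ((e ≟ f) ×-dec (a Fin.≟ b))

-- Lexicographic order, so siblings appear by increasing last letter.
invSeqs : ∀ n → List (InvSeq n)
invSeqs zero    = ε ∷ []
invSeqs (suc n) = cartesianProductWith _▹_ (invSeqs n) (allFin (suc n))

invSeqs-complete : ∀ {n} (e : InvSeq n) → e ∈ invSeqs n
invSeqs-complete ε       = here refl
invSeqs-complete (e ▹ a) =
  ∈-cartesianProductWith⁺ _▹_ (invSeqs-complete e) (∈-allFin a)

invSeqs-unique : ∀ n → Unique (invSeqs n)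
invSeqs-unique zero    = All.[] ∷ []
invSeqs-unique (suc n) =
  Unique.cartesianProductWith⁺ _▹_ (λ { refl → refl , refl })
    (invSeqs-unique n) (Unique.allFin⁺ (suc n))

------------------------------------------------------------------------
-- Pattern avoidance

OrderIso : ∀ {k} → Vec ℕ k → Vec ℕ k → Set
OrderIso s t = ∀ i j →
  (lookup s i < lookup s j ⇔ lookup t i < lookup t j) ×
  (lookup s i ≡ lookup s j ⇔ lookup t i ≡ lookup t j)

Contains : List ℕ → List ℕ → Set
Contains τ w = ∃ λ (s : Vec ℕ (length τ)) →
  toList s ⊆ w × OrderIso s (fromList τ)

Avoids : ∀ {n} → List (List ℕ) → InvSeq n → Set
Avoids B e = All (λ τ → ¬ Contains τ (letters e)) B

_⇔?_ : ∀ {P Q : Set} → Dec P → Dec Q → Dec (P ⇔ Q)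
p? ⇔? q? = map′ (λ { (f , g) → mk⇔ f g })
                (λ e → Equivalence.to e , Equivalence.from e)
                ((p? →-dec q?) ×-dec (q? →-dec p?))

orderIso? : ∀ {k} (s t : Vec ℕ k) → Dec (OrderIso s t)
orderIso? s t = Fin.all? λ i → Fin.all? λ j →
  ((lookup s i ℕ.<? lookup s j) ⇔? (lookup t i ℕ.<? lookup t j)) ×-dec
  ((lookup s i ℕ.≟ lookup s j) ⇔? (lookup t i ℕ.≟ lookup t j))

anySublist? : ∀ {k} {P : Vec ℕ k → Set} → Decidable P →
              ∀ w → Dec (∃ λ s → toList s ⊆ w × P s)
anySublist? {zero} P? w =
  map′ (λ p → [] , Sublist.minimum w , p) (λ { ([] , _ , p) → p }) (P? [])
anySublist? {suc k} P? [] = no λ { (_ ∷ _ , () , _) }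
anySublist? {suc k} {P} P? (x ∷ w) =
  map′ [ (λ { (s , s⊆w , p) → s , x Sublist.∷ʳ s⊆w , p })
       , (λ { (s , s⊆w , p) → x ∷ s , refl Sublist.∷ s⊆w , p }) ]′
       split
       (anySublist? P? w ⊎-dec anySublist? (λ s → P? (x ∷ s)) w)
  where
  split : (∃ λ s → toList s ⊆ x ∷ w × P s) →
          (∃ λ s → toList s ⊆ w × P s) ⊎ (∃ λ s → toList s ⊆ w × P (x ∷ s))
  split (y ∷ s , _ Sublist.∷ʳ s⊆w   , p) = inj₁ (y ∷ s , s⊆w , p)
  split (_ ∷ s , refl Sublist.∷ s⊆w , p) = inj₂ (s , s⊆w , p)

contains? : ∀ τ w → Dec (Contains τ w)
contains? τ = anySublist? (λ s → orderIso? s (fromList τ))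

avoids? : ∀ {n} B → Decidable (Avoids {n} B)
avoids? B e = All.all? (λ τ → ¬? (contains? τ (letters e))) B

avoiders : List (List ℕ) → ∀ n → List (InvSeq n)
avoiders B n = filter (avoids? B) (invSeqs n)

-- Iₙ(B)
I⟨_⟩ : List (List ℕ) → ∀ n → List (I n)
I⟨ B ⟩ n = avoiders B (suc n)

------------------------------------------------------------------------
-- The tree 𝒯(B)

-- The nodes of 𝒯(B) at level n are the elements of I⟨ B ⟩ n, and the node
-- above d is parent d.  Prefixes of avoiders are avoiders, so the
-- nodes of 𝒯(B; e) at distance ℓ below e are those whose ℓ-th ancestor is e.
subtreeLevel : List (List ℕ) → ∀ {n} → InvSeq n → ∀ ℓ → List (InvSeq (ℓ + n))
subtreeLevel B {n} e ℓ =
  filter (λ d → ancestor ℓ d ≟ e) (avoiders B (ℓ + n))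

------------------------------------------------------------------------
-- Formal power series in x

infix  4 _≈_
infixl 6 _⊕_ _⊖_
infixl 7 _⊛_
infixr 8 _^_

Series : Set
Series = ℕ → ℤ

_≈_ : Series → Series → Set
f ≈ g = ∀ n → f n ≡ g n

0ₛ 1ₛ X : Series
0ₛ _ = 0ℤ
1ₛ zero    = 1ℤ
1ₛ (suc _) = 0ℤ
X zero          = 0ℤ
X (suc zero)    = 1ℤ
X (suc (suc _)) = 0ℤ

_⊕_ _⊖_ _⊛_ : Series → Series → Series
(f ⊕ g) n = f n ℤ.+ g n
(f ⊖ g) n = f n ℤ.- g n
(f ⊛ g) n = ∑[ k ≤ n ] (f (toℕ k) ℤ.* g (n ∸ toℕ k))

_^_ : Series → ℕ → Series
f ^ zero  = 1ₛ
f ^ suc k = f ⊛ f ^ k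

1/[1-X] : Series
1/[1-X] _ = 1ℤ

1/[1-X]-inverse : (1ₛ ⊖ X) ⊛ 1/[1-X] ≈ 1ₛ
1/[1-X]-inverse zero          = refl
1/[1-X]-inverse (suc n) =
  cong (λ z → 1ℤ ℤ.+ (ℤ.- 1ℤ ℤ.+ z)) (sum-replicate-zero n)

-- ∑ₙ c(n) xⁿ⁺¹
shiftedGF : (ℕ → ℕ) → Series
shiftedGF c zero    = 0ℤ
shiftedGF c (suc n) = ℤ.+ c n

------------------------------------------------------------------------
-- Further variables

-- ℤ[[x]][[v]]: F k is the coefficient of vᵏ.
SeriesV : Set
SeriesV = ℕ → Series

-- F evaluated at v = s, i.e. ∑ₖ F k · sᵏ.  As s has no constant term, sᵏ
-- has no terms below xᵏ, so only k ≤ n contribute to the coefficient of xⁿ.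
subst-v : SeriesV → (s : Series) → .(s 0 ≡ 0ℤ) → Series
subst-v F s _ n = ∑[ k ≤ n ] ((F (toℕ k) ⊛ s ^ toℕ k) n)

-- ℤ[[x]][u], as lists of coefficients by increasing degree.
PolyU : Set
PolyU = List Series

infixl 6 _⊞_

_⊞_ : PolyU → PolyU → PolyU
[]      ⊞ q       = q
(c ∷ p) ⊞ []      = c ∷ p
(c ∷ p) ⊞ (d ∷ q) = (c ⊕ d) ∷ (p ⊞ q)

monomial : Series → ℕ → PolyU
monomial c i = replicate i 0ₛ ∷ʳ c

eval-u : Series → PolyU → Series
eval-u t = foldr (λ c r → c ⊕ t ⊛ r) 0ₛ

-- ℤ[[x]][u][[v]], the smallest natural home of B(x,v,u), in which u = 1
-- can be substituted.
SeriesVU : Set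
SeriesVU = ℕ → PolyU

------------------------------------------------------------------------
-- The generating functions

levelGF : List (List ℕ) → Series
levelGF B = shiftedGF (λ n → length (I⟨ B ⟩ n))

subtreeGF : List (List ℕ) → ∀ {n} → InvSeq n → Series
subtreeGF B e = shiftedGF (λ ℓ → length (subtreeLevel B e ℓ))

module _ (B : List (List ℕ)) where

  A[_] : ℕ → Series
  A[ m ] = subtreeGF B (zeros m)

  -- B[ m , i ] is B_{m,j} for j = i + 1, so that i : Fin m encodes 1 ≤ j ≤ m.
  B[_,_] : (m : ℕ) → Fin m → Series
  B[ m , i ] = subtreeGF B (zeros m ▹ suc i)

  A⟨x,v⟩ : SeriesV
  A⟨x,v⟩ k = A[ suc k ]

  B⟨x,v,u⟩ : SeriesVU
  B⟨x,v,u⟩ k =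
    foldr _⊞_ [] (map (λ i → monomial B[ m , i ] (m ∸ suc (toℕ i))) (allFin m))
    where m = suc k

  A⟨x,0⟩ : Series
  A⟨x,0⟩ = subst-v A⟨x,v⟩ 0ₛ refl

  B⟨x,x,1⟩ : Series
  B⟨x,x,1⟩ = subst-v (λ k → eval-u 1ₛ (B⟨x,v,u⟩ k)) X refl

{-# OPTIONS --safe #-}
module Submission where

-- The root of the tree is 0, so all avoiders descend from it, and putting
-- v = 0 in A(x,v) leaves A₁(x); this is the first equation
-- (levelGF≈A₁, A⟨x,0⟩≈A₁).
--
-- For the second, a node e contributes x, and the remaining nodes of its
-- subtree are split according to the child of e above them
-- (subtreeGF-children).  The children of 0ᵐ are 0ᵐ⁺¹ and the words 0ᵐj with
-- 1 ≤ j ≤ m, and 0ᵐ is itself a node because neither pattern is constant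
-- (nonconstant-zeros).  Hence, with Sₘ = ∑ⱼ Bₘ,ⱼ,
--
--     Aₘ = x + x Aₘ₊₁ + x Sₘ.
--
-- Unrolling this from m = 1 gives A₁ = ∑ₘ xᵐ + ∑ₘ xᵐ Sₘ (A-unrolled); the
-- unrolling is finite in each degree, as Aₘ has no constant term.  On the
-- other side, B(x,v,1) = ∑ₘ Sₘ vᵐ⁻¹ (B⟨x,v,1⟩-coefficient), so the second sum
-- is x B(x,x,1) (B⟨x,x,1⟩-coefficient).
--
-- Nothing else about the patterns matters: the argument works for every B
-- that is avoided by all the words 0ᵐ.

open import Defs
open import Data.Fin using (Fin; zero; suc; toℕ; punchIn)
open import Data.Fin.Properties using (punchInᵢ≢i; toℕ≤pred[n])
open import Data.Integer as ℤ using (ℤ; 0ℤ; 1ℤ)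
import Data.Integer.Properties as ℤ
open import Data.List using (List; []; _∷_; length; filter; map; foldr; tabulate)
open import Data.List.Membership.Propositional using (_∈_)
open import Data.List.Membership.Propositional.Properties using (∈-filter⁺)
open import Data.List.Properties using (filter-all; filter-accept; filter-reject; filter-none; map-tabulate)
open import Data.List.Relation.Binary.Sublist.Propositional.Properties using (All-resp-⊆)
open import Data.List.Relation.Unary.All as All using (All; []; _∷_)
open import Data.List.Relation.Unary.All.Properties using (∷ʳ⁺)
open import Data.List.Relation.Unary.AllPairs using (_∷_)
open import Data.List.Relation.Unary.Any using (here; there)
open import Data.List.Relation.Unary.Unique.Propositional using (Unique)
import Data.List.Relation.Unary.Unique.Propositional.Properties as Unique
open import Data.Nat as ℕ using (ℕ; zero; suc; _+_; _∸_; _≤_; _<_; z≤n; s≤s)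
import Data.Nat.Properties as ℕ
open import Data.Product using (_×_; _,_; proj₁; proj₂)
open import Data.Vec using (Vec; []; _∷_; lookup; toList; fromList)
open import Function using (_∘_; id)
open import Function.Bundles using (Equivalence)
open import Relation.Binary.Definitions using (DecidableEquality)
open import Relation.Binary.PropositionalEquality
  using (_≡_; _≢_; refl; sym; trans; cong; cong₂; subst; module ≡-Reasoning)
open import Relation.Nullary using (¬_; yes; no)
open import Relation.Unary using (Decidable)
open import Algebra.Properties.CommutativeSemigroup ℤ.+-commutativeSemigroup using (interchange)
open import Algebra.Properties.CommutativeMonoid.Sum ℤ.+-0-commutativeMonoid
  using (sum; sum-syntax; sum⁺-syntax; sum-cong-≗; sum-replicate-zero; sum-remove; ∑-distrib-+)

open ≡-Reasoning

-- Finite sums and counting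

∑-zero : ∀ {n} (f : Fin n → ℤ) → (∀ i → f i ≡ 0ℤ) → ∑[ i < n ] f i ≡ 0ℤ
∑-zero {n} f f≡0 = trans (sum-cong-≗ f≡0) (sum-replicate-zero n)

∑-single : ∀ {n} (f : Fin n → ℤ) i → (∀ j → j ≢ i → f j ≡ 0ℤ) →
           ∑[ j < n ] f j ≡ f i
∑-single {suc n} f i f≡0 = begin
  sum f                                 ≡⟨ sum-remove {i = i} f ⟩
  f i ℤ.+ ∑[ j < n ] f (punchIn i j)    ≡⟨ cong (ℤ._+_ (f i)) (∑-zero (f ∘ punchIn i) λ j → f≡0 _ (punchInᵢ≢i i j)) ⟩
  f i ℤ.+ 0ℤ                            ≡⟨ ℤ.+-identityʳ (f i) ⟩
  f i                                   ∎

-- The number of elements of a list that satisfy P, as an integer, so that it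
-- can be compared with coefficients of series.
count : ∀ {A : Set} {P : A → Set} → Decidable P → List A → ℤ
count P? xs = ℤ.+ length (filter P? xs)

module _ {A : Set} {P : A → Set} (P? : Decidable P) where

  count-∷ : ∀ x xs → count P? (x ∷ xs) ≡ count P? (x ∷ []) ℤ.+ count P? xs
  count-∷ x xs with P? x
  ... | yes _ = refl
  ... | no  _ = refl

  count-yes : ∀ {x} → P x → count P? (x ∷ []) ≡ 1ℤ
  count-yes p = cong (λ ys → ℤ.+ length ys) (filter-accept P? p)

  count-no : ∀ {x} → ¬ P x → count P? (x ∷ []) ≡ 0ℤ
  count-no ¬p = cong (λ ys → ℤ.+ length ys) (filter-reject P? ¬p)

-- The elements satisfying P are partitioned by the value of f on them.
count-partition :
  ∀ {A : Set} {k} {P : A → Set} {Q : Fin k → A → Set}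
  (P? : Decidable P) (Q? : ∀ i → Decidable (Q i)) (f : A → Fin k) →
  (∀ {i x} → Q i x → P x × f x ≡ i) → (∀ {x} → P x → Q (f x) x) →
  ∀ xs → count P? xs ≡ ∑[ i < k ] count (Q? i) xs
count-partition {k = k} P? Q? f Q⇒P P⇒Q []       = sym (sum-replicate-zero k)
count-partition {k = k} P? Q? f Q⇒P P⇒Q (x ∷ xs) = begin
  count P? (x ∷ xs)
    ≡⟨ count-∷ P? x xs ⟩
  count P? (x ∷ []) ℤ.+ count P? xs
    ≡⟨ cong₂ ℤ._+_ singleton (count-partition P? Q? f Q⇒P P⇒Q xs) ⟩
  ∑[ i < k ] count (Q? i) (x ∷ []) ℤ.+ ∑[ i < k ] count (Q? i) xs
    ≡⟨ ∑-distrib-+ (λ i → count (Q? i) (x ∷ [])) (λ i → count (Q? i) xs) ⟨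
  ∑[ i < k ] (count (Q? i) (x ∷ []) ℤ.+ count (Q? i) xs)
    ≡⟨ sum-cong-≗ (λ i → sym (count-∷ (Q? i) x xs)) ⟩
  ∑[ i < k ] count (Q? i) (x ∷ xs) ∎
  where
  singleton : count P? (x ∷ []) ≡ ∑[ i < k ] count (Q? i) (x ∷ [])
  singleton with P? x
  ... | yes p = sym (trans
    (∑-single _ (f x) λ i i≢fx →
      count-no (Q? i) λ q → i≢fx (sym (proj₂ (Q⇒P q))))
    (count-yes (Q? (f x)) (P⇒Q p)))
  ... | no ¬p = sym (∑-zero _ λ i → count-no (Q? i) (¬p ∘ proj₁ ∘ Q⇒P))

count-unique : ∀ {A : Set} (_≟A_ : DecidableEquality A) {x xs} →
               Unique xs → x ∈ xs → count (_≟A x) xs ≡ 1ℤ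
count-unique _≟A_ {x} {_ ∷ xs} (x∉xs ∷ _) (here refl) = begin
  count (_≟A x) (x ∷ xs)
    ≡⟨ cong (λ ys → ℤ.+ length ys) (filter-accept (_≟A x) refl) ⟩
  ℤ.+ suc (length (filter (_≟A x) xs))
    ≡⟨ cong (λ ys → ℤ.+ suc (length ys)) (filter-none (_≟A x) (All.map (λ x≢y y≡x → x≢y (sym y≡x)) x∉xs)) ⟩
  1ℤ ∎
count-unique _≟A_ {x} (y∉xs ∷ u) (there x∈xs) = trans
  (cong (λ ys → ℤ.+ length ys) (filter-reject (_≟A x) (All.lookup y∉xs x∈xs)))
  (count-unique _≟A_ u x∈xs)

-- Products of power series

X-⊛-suc : ∀ f n → (X ⊛ f) (suc n) ≡ f n
X-⊛-suc f n = begin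
  0ℤ ℤ.+ (1ℤ ℤ.* f n ℤ.+ rest)   ≡⟨ ℤ.+-identityˡ _ ⟩
  1ℤ ℤ.* f n ℤ.+ rest            ≡⟨ cong₂ ℤ._+_ (ℤ.*-identityˡ (f n)) (sum-replicate-zero n) ⟩
  f n ℤ.+ 0ℤ                     ≡⟨ ℤ.+-identityʳ (f n) ⟩
  f n                            ∎
  where rest = ∑[ k < n ] 0ℤ

0ₛ-⊛ : ∀ f → 0ₛ ⊛ f ≈ 0ₛ
0ₛ-⊛ f n = sum-replicate-zero (suc n)

⊛-zeroʳ : ∀ f {g} → g ≈ 0ₛ → f ⊛ g ≈ 0ₛ
⊛-zeroʳ f g≈0 n = ∑-zero {suc n} _ λ k →
  trans (cong (ℤ._*_ (f (toℕ k))) (g≈0 (n ∸ toℕ k))) (ℤ.*-zeroʳ (f (toℕ k)))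

⊛-constant : ∀ f g → (f ⊛ g) 0 ≡ f 0 ℤ.* g 0
⊛-constant f g = ℤ.+-identityʳ (f 0 ℤ.* g 0)

1ₛ-⊛ : ∀ f → 1ₛ ⊛ f ≈ f
1ₛ-⊛ f n = begin
  1ℤ ℤ.* f n ℤ.+ ∑[ k < n ] 0ℤ   ≡⟨ cong₂ ℤ._+_ (ℤ.*-identityˡ (f n)) (sum-replicate-zero n) ⟩
  f n ℤ.+ 0ℤ                     ≡⟨ ℤ.+-identityʳ (f n) ⟩
  f n                            ∎

-- The induction replaces f by f ∘ suc, since (f ⊛ g) (suc n) unfolds to
-- f 0 ℤ.* g (suc n) ℤ.+ ((f ∘ suc) ⊛ g) n.
⊛-1ₛ : ∀ f → f ⊛ 1ₛ ≈ f
⊛-1ₛ f zero    = trans (⊛-constant f 1ₛ) (ℤ.*-identityʳ (f 0))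
⊛-1ₛ f (suc n) = begin
  f 0 ℤ.* 0ℤ ℤ.+ ((f ∘ suc) ⊛ 1ₛ) n   ≡⟨ cong₂ ℤ._+_ (ℤ.*-zeroʳ (f 0)) (⊛-1ₛ (f ∘ suc) n) ⟩
  0ℤ ℤ.+ f (suc n)                    ≡⟨ ℤ.+-identityˡ (f (suc n)) ⟩
  f (suc n)                           ∎

⊛-X-⊛-suc : ∀ f g n → (f ⊛ (X ⊛ g)) (suc n) ≡ (f ⊛ g) n
⊛-X-⊛-suc f g zero    = cong₂ ℤ._+_
  (cong (ℤ._*_ (f 0)) (X-⊛-suc g 0))
  (trans (⊛-constant (f ∘ suc) (X ⊛ g)) (ℤ.*-zeroʳ (f 1)))
⊛-X-⊛-suc f g (suc n) = cong₂ ℤ._+_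
  (cong (ℤ._*_ (f 0)) (X-⊛-suc g (suc n)))
  (⊛-X-⊛-suc (f ∘ suc) g n)

⊛-X^ : ∀ f {k n} → k ≤ n → (f ⊛ X ^ k) n ≡ f (n ∸ k)
⊛-X^ f {n = n} z≤n             = ⊛-1ₛ f n
⊛-X^ f {suc k} {suc n} (s≤s k≤n) = trans (⊛-X-⊛-suc f (X ^ k) n) (⊛-X^ f k≤n)

subst-v-0 : ∀ F → subst-v F 0ₛ refl ≈ F 0
subst-v-0 F n = begin
  (F 0 ⊛ 1ₛ) n ℤ.+ ∑[ k < n ] ((F (suc (toℕ k)) ⊛ 0ₛ ^ suc (toℕ k)) n)
    ≡⟨ cong₂ ℤ._+_ (⊛-1ₛ (F 0) n)
         (∑-zero {n} _ λ k → ⊛-zeroʳ (F (suc (toℕ k))) (0ₛ-⊛ (0ₛ ^ toℕ k)) n) ⟩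
  F 0 n ℤ.+ 0ℤ
    ≡⟨ ℤ.+-identityʳ (F 0 n) ⟩
  F 0 n ∎

subst-v-X : ∀ F n → subst-v F X refl n ≡ ∑[ k ≤ n ] F (toℕ k) (n ∸ toℕ k)
subst-v-X F n = sum-cong-≗ {suc n} λ k → ⊛-X^ (F (toℕ k)) (toℕ≤pred[n] k)

-- Evaluation at u = 1

eval-1-∷ : ∀ c p → eval-u 1ₛ (c ∷ p) ≈ c ⊕ eval-u 1ₛ p
eval-1-∷ c p n = cong (ℤ._+_ (c n)) (1ₛ-⊛ (eval-u 1ₛ p) n)

eval-1-⊞ : ∀ p q → eval-u 1ₛ (p ⊞ q) ≈ eval-u 1ₛ p ⊕ eval-u 1ₛ q
eval-1-⊞ []      q       n = sym (ℤ.+-identityˡ _)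
eval-1-⊞ (c ∷ p) []      n = sym (ℤ.+-identityʳ _)
eval-1-⊞ (c ∷ p) (d ∷ q) n = begin
  eval-u 1ₛ ((c ⊕ d) ∷ (p ⊞ q)) n
    ≡⟨ eval-1-∷ (c ⊕ d) (p ⊞ q) n ⟩
  (c n ℤ.+ d n) ℤ.+ eval-u 1ₛ (p ⊞ q) n
    ≡⟨ cong (ℤ._+_ (c n ℤ.+ d n)) (eval-1-⊞ p q n) ⟩
  (c n ℤ.+ d n) ℤ.+ (eval-u 1ₛ p n ℤ.+ eval-u 1ₛ q n)
    ≡⟨ interchange (c n) (d n) _ _ ⟩
  (c n ℤ.+ eval-u 1ₛ p n) ℤ.+ (d n ℤ.+ eval-u 1ₛ q n)
    ≡⟨ cong₂ ℤ._+_ (eval-1-∷ c p n) (eval-1-∷ d q n) ⟨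
  eval-u 1ₛ (c ∷ p) n ℤ.+ eval-u 1ₛ (d ∷ q) n ∎

eval-1-monomial : ∀ c i → eval-u 1ₛ (monomial c i) ≈ c
eval-1-monomial c zero    n = trans (eval-1-∷ c [] n) (ℤ.+-identityʳ (c n))
eval-1-monomial c (suc i) n = begin
  eval-u 1ₛ (0ₛ ∷ monomial c i) n        ≡⟨ eval-1-∷ 0ₛ (monomial c i) n ⟩
  0ℤ ℤ.+ eval-u 1ₛ (monomial c i) n      ≡⟨ ℤ.+-identityˡ _ ⟩
  eval-u 1ₛ (monomial c i) n             ≡⟨ eval-1-monomial c i n ⟩
  c n                                    ∎

eval-1-∑ : ∀ {m} (p : Fin m → PolyU) n →
           eval-u 1ₛ (foldr _⊞_ [] (tabulate p)) n ≡ ∑[ i < m ] eval-u 1ₛ (p i) n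
eval-1-∑ {zero}  p n = refl
eval-1-∑ {suc m} p n = trans (eval-1-⊞ (p zero) _ n)
  (cong (ℤ._+_ (eval-u 1ₛ (p zero) n)) (eval-1-∑ (p ∘ suc) n))

-- Subtrees and the children of their roots

lastLetter : ∀ {n} → InvSeq (suc n) → Fin (suc n)
lastLetter (_ ▹ a) = a

parent-▹-lastLetter : ∀ {n} (e : InvSeq (suc n)) → e ≡ parent e ▹ lastLetter e
parent-▹-lastLetter (_ ▹ _) = refl

parent-subst : ∀ {m n} (p : m ≡ n) (q : suc m ≡ suc n) (d : InvSeq (suc m)) →
               parent (subst InvSeq q d) ≡ subst InvSeq p (parent d)
parent-subst refl refl d = refl

-- As ancestor strips letters from the right, taking one more ancestor is the
-- same as taking the parent at the end, up to the identification of lengths.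
ancestor-suc : ∀ ℓ {n} (p : suc ℓ + n ≡ ℓ + suc n) (d : InvSeq (suc ℓ + n)) →
               ancestor (suc ℓ) d ≡ parent (ancestor ℓ (subst InvSeq p d))
ancestor-suc zero    refl d = refl
ancestor-suc (suc ℓ) p    d = begin
  ancestor (suc ℓ) (parent d)                       ≡⟨ ancestor-suc ℓ q (parent d) ⟩
  parent (ancestor ℓ (subst InvSeq q (parent d)))   ≡⟨ cong (parent ∘ ancestor ℓ) (parent-subst q p d) ⟨
  parent (ancestor ℓ (parent (subst InvSeq p d)))   ∎
  where q = ℕ.suc-injective p

count-subst : ∀ {F : ℕ → Set} (L : ∀ n → List (F n)) {m n} (p : m ≡ n)
              {P : F n → Set} (P? : Decidable P) →
              count P? (L n) ≡ count (λ d → P? (subst F p d)) (L m)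
count-subst L refl P? = refl

module _ (B : List (List ℕ)) where

  subtreeLevel-suc : ∀ {n} (e : InvSeq n) ℓ →
    ℤ.+ length (subtreeLevel B e (suc ℓ)) ≡
    ∑[ a ≤ n ] (ℤ.+ length (subtreeLevel B (e ▹ a) ℓ))
  subtreeLevel-suc {n} e ℓ = begin
    count (λ d → ancestor (suc ℓ) d ≟ e) (avoiders B (suc ℓ + n))
      ≡⟨ count-partition _ (λ a d → child d ≟ (e ▹ a)) (lastLetter ∘ child)
           child⇒ ⇒child (avoiders B (suc ℓ + n)) ⟩
    ∑[ a ≤ n ] count (λ d → child d ≟ (e ▹ a)) (avoiders B (suc ℓ + n))
      ≡⟨ sum-cong-≗ (λ a → sym (count-subst (avoiders B) p (λ d → ancestor ℓ d ≟ (e ▹ a)))) ⟩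
    ∑[ a ≤ n ] count (λ d → ancestor ℓ d ≟ (e ▹ a)) (avoiders B (ℓ + suc n)) ∎
    where
    p : suc ℓ + n ≡ ℓ + suc n
    p = sym (ℕ.+-suc ℓ n)

    child : InvSeq (suc ℓ + n) → InvSeq (suc n)
    child d = ancestor ℓ (subst InvSeq p d)

    child⇒ : ∀ {a d} → child d ≡ e ▹ a →
             ancestor (suc ℓ) d ≡ e × lastLetter (child d) ≡ a
    child⇒ {a} {d} eq = trans (ancestor-suc ℓ p d) (cong parent eq) , cong lastLetter eq

    ⇒child : ∀ {d} → ancestor (suc ℓ) d ≡ e → child d ≡ e ▹ lastLetter (child d)
    ⇒child {d} eq = trans (parent-▹-lastLetter (child d))
      (cong (_▹ lastLetter (child d)) (trans (sym (ancestor-suc ℓ p d)) eq))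

  subtreeLevel-zero : ∀ {n} (e : InvSeq n) → Avoids B e →
                      ℤ.+ length (subtreeLevel B e 0) ≡ 1ℤ
  subtreeLevel-zero {n} e av = count-unique _≟_
    (Unique.filter⁺ (avoids? B) (invSeqs-unique n))
    (∈-filter⁺ (avoids? B) (invSeqs-complete e) av)

  -- Coefficientwise form of subtreeGF e = x (1 + ∑ₐ subtreeGF (e ▹ a)).
  subtreeGF-children : ∀ {m} (e : InvSeq m) → Avoids B e → ∀ n →
    subtreeGF B e (suc n) ≡ 1ₛ n ℤ.+ ∑[ a ≤ m ] subtreeGF B (e ▹ a) n
  subtreeGF-children {m} e av zero    = trans (subtreeLevel-zero e av)
    (cong (ℤ._+_ 1ℤ) (sym (sum-replicate-zero (suc m))))
  subtreeGF-children e av (suc ℓ) = trans (subtreeLevel-suc e ℓ) (sym (ℤ.+-identityˡ _))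

-- The generating functions A and B

  ancestor-root : ∀ n (d : InvSeq (n + 1)) → ancestor n d ≡ zeros 1
  ancestor-root zero    (ε ▹ zero) = refl
  ancestor-root (suc n) d          = ancestor-root n (parent d)

  levelGF≈A₁ : levelGF B ≈ A[_] B 1
  levelGF≈A₁ zero    = refl
  levelGF≈A₁ (suc n) = cong ℤ.+_ (begin
    length (avoiders B (suc n))    ≡⟨ cong (length ∘ avoiders B) (ℕ.+-comm 1 n) ⟩
    length (avoiders B (n + 1))    ≡⟨ cong length (filter-all (λ d → ancestor n d ≟ zeros 1)
                                                  (All.universal (ancestor-root n) (avoiders B (n + 1)))) ⟨
    length (subtreeLevel B (zeros 1) n) ∎)

  A⟨x,0⟩≈A₁ : A⟨x,0⟩ B ≈ A[_] B 1
  A⟨x,0⟩≈A₁ = subst-v-0 (A⟨x,v⟩ B)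

  -- The sum of B_{m,j} over 1 ≤ j ≤ m.
  S : ℕ → Series
  S m n = ∑[ i < m ] B[_,_] B m i n

  B⟨x,v,1⟩-coefficient : ∀ k → eval-u 1ₛ (B⟨x,v,u⟩ B k) ≈ S (suc k)
  B⟨x,v,1⟩-coefficient k n = begin
    eval-u 1ₛ (foldr _⊞_ [] (map term (tabulate id))) n
      ≡⟨ cong (λ ps → eval-u 1ₛ (foldr _⊞_ [] ps) n) (map-tabulate id term) ⟩
    eval-u 1ₛ (foldr _⊞_ [] (tabulate term)) n
      ≡⟨ eval-1-∑ term n ⟩
    ∑[ i ≤ k ] eval-u 1ₛ (term i) n
      ≡⟨ sum-cong-≗ (λ i → eval-1-monomial (B[_,_] B (suc k) i) (k ∸ toℕ i) n) ⟩
    S (suc k) n ∎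
    where
    term : Fin (suc k) → PolyU
    term i = monomial (B[_,_] B (suc k) i) (k ∸ toℕ i)

  B⟨x,x,1⟩-coefficient : ∀ n →
    B⟨x,x,1⟩ B n ≡ ∑[ k ≤ n ] S (suc (toℕ k)) (n ∸ toℕ k)
  B⟨x,x,1⟩-coefficient n = trans (subst-v-X (λ k → eval-u 1ₛ (B⟨x,v,u⟩ B k)) n)
    (sum-cong-≗ {suc n} λ k → B⟨x,v,1⟩-coefficient (toℕ k) (n ∸ toℕ k))

  module _ (zeros-avoid : ∀ m → Avoids B (zeros m)) where

    -- Coefficientwise form of Aₘ = x (∑ₖ xᵏ + ∑ₖ xᵏ Sₘ₊ₖ), both sums over k ≥ 0.
    A-unrolled : ∀ n m →
      A[_] B m (suc n) ≡ 1ℤ ℤ.+ ∑[ k ≤ n ] S (toℕ k + m) (n ∸ toℕ k)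
    A-unrolled zero    m = begin
      A[_] B m 1                   ≡⟨ subtreeGF-children (zeros m) (zeros-avoid m) 0 ⟩
      1ℤ ℤ.+ (0ℤ ℤ.+ S m 0)        ≡⟨ cong (ℤ._+_ 1ℤ) (ℤ.+-comm 0ℤ (S m 0)) ⟩
      1ℤ ℤ.+ (S m 0 ℤ.+ 0ℤ)        ∎
    A-unrolled (suc n) m = begin
      A[_] B m (suc (suc n))
        ≡⟨ subtreeGF-children (zeros m) (zeros-avoid m) (suc n) ⟩
      0ℤ ℤ.+ (A[_] B (suc m) (suc n) ℤ.+ S m (suc n))
        ≡⟨ ℤ.+-identityˡ _ ⟩
      A[_] B (suc m) (suc n) ℤ.+ S m (suc n)
        ≡⟨ cong (ℤ._+ S m (suc n)) (A-unrolled n (suc m)) ⟩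
      (1ℤ ℤ.+ ∑[ k ≤ n ] S (toℕ k + suc m) (n ∸ toℕ k)) ℤ.+ S m (suc n)
        ≡⟨ ℤ.+-assoc 1ℤ (∑[ k ≤ n ] S (toℕ k + suc m) (n ∸ toℕ k)) (S m (suc n)) ⟩
      1ℤ ℤ.+ (∑[ k ≤ n ] S (toℕ k + suc m) (n ∸ toℕ k) ℤ.+ S m (suc n))
        ≡⟨ cong (ℤ._+_ 1ℤ) (ℤ.+-comm _ (S m (suc n))) ⟩
      1ℤ ℤ.+ (S m (suc n) ℤ.+ ∑[ k ≤ n ] S (toℕ k + suc m) (n ∸ toℕ k))
        ≡⟨ cong (λ z → 1ℤ ℤ.+ (S m (suc n) ℤ.+ z))
             (sum-cong-≗ {suc n} λ k → cong (λ j → S j (n ∸ toℕ k)) (ℕ.+-suc (toℕ k) m)) ⟩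
      1ℤ ℤ.+ (S m (suc n) ℤ.+ ∑[ k ≤ n ] S (suc (toℕ k) + m) (n ∸ toℕ k)) ∎

    A₁≈ : A[_] B 1 ≈ X ⊛ 1/[1-X] ⊕ X ⊛ B⟨x,x,1⟩ B
    A₁≈ zero    = refl
    A₁≈ (suc n) = begin
      A[_] B 1 (suc n)
        ≡⟨ A-unrolled n 1 ⟩
      1ℤ ℤ.+ ∑[ k ≤ n ] S (toℕ k + 1) (n ∸ toℕ k)
        ≡⟨ cong (ℤ._+_ 1ℤ) (sum-cong-≗ {suc n} λ k → cong (λ j → S j (n ∸ toℕ k)) (ℕ.+-comm (toℕ k) 1)) ⟩
      1ℤ ℤ.+ ∑[ k ≤ n ] S (suc (toℕ k)) (n ∸ toℕ k)
        ≡⟨ cong₂ ℤ._+_ (X-⊛-suc 1/[1-X] n)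
             (trans (X-⊛-suc (B⟨x,x,1⟩ B) n) (B⟨x,x,1⟩-coefficient n)) ⟨
      (X ⊛ 1/[1-X]) (suc n) ℤ.+ (X ⊛ B⟨x,x,1⟩ B) (suc n) ∎

-- The words 0ᵐ as avoiders

letters-zeros : ∀ m → All (_≡ 0) (letters (zeros m))
letters-zeros zero    = []
letters-zeros (suc m) = ∷ʳ⁺ (letters-zeros m) refl

lookup-toList : ∀ {k} {P : ℕ → Set} (s : Vec ℕ k) → All P (toList s) →
                ∀ i → P (lookup s i)
lookup-toList (_ ∷ _) (p ∷ _)  zero    = p
lookup-toList (_ ∷ s) (_ ∷ ps) (suc i) = lookup-toList s ps i

nonconstant-zeros : ∀ τ (i j : Fin (length τ)) →
  lookup (fromList τ) i < lookup (fromList τ) j →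
  ∀ m → ¬ Contains τ (letters (zeros m))
nonconstant-zeros τ i j τᵢ<τⱼ m (s , s⊆0 , iso) =
  ℕ.<-irrefl (trans (s≡0 i) (sym (s≡0 j))) (Equivalence.from (proj₁ (iso i j)) τᵢ<τⱼ)
  where
  s≡0 : ∀ k → lookup s k ≡ 0
  s≡0 = lookup-toList s (All-resp-⊆ s⊆0 (letters-zeros m))

theorem4p12 : let B = (1 ∷ 2 ∷ 0 ∷ []) ∷ (2 ∷ 1 ∷ 0 ∷ []) ∷ [] in
    (levelGF B ≈ A⟨x,0⟩ B) ×
    (A⟨x,0⟩ B ≈ X ⊛ 1/[1-X] ⊕ X ⊛ B⟨x,x,1⟩ B)
theorem4p12 =
  (λ n → trans (levelGF≈A₁ B n) (sym (A⟨x,0⟩≈A₁ B n))) ,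
  (λ n → trans (A⟨x,0⟩≈A₁ B n) (A₁≈ B zeros-avoid n))
  where
  B : List (List ℕ)
  B = (1 ∷ 2 ∷ 0 ∷ []) ∷ (2 ∷ 1 ∷ 0 ∷ []) ∷ []

  -- In each pattern the given positions hold the letters 1 and 2.
  zeros-avoid : ∀ m → Avoids B (zeros m)
  zeros-avoid m =
    nonconstant-zeros _ zero (suc zero) (s≤s (s≤s z≤n)) m ∷
    nonconstant-zeros _ (suc zero) zero (s≤s (s≤s z≤n)) m ∷ []
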